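{- If $A\subseteq\mathbb{Z}^d$ and $B\subset A$ both possess affine stratifications, then $A\setminus B$ possesses an affine stratification.
   Context: An affine semigroup is a finitely generated submonoid of $\mathbb{Z}^d$. An affine stratification of a subset $\mathcal{W}\subseteq\mathbb{Z}^d$ is a partition $\mathcal{W}=\biguplus_{i=1}^r W_i$ into finitely many pairwise disjoint sets $W_i$, each of the form $W_i=F_i+A_i$ with $F_i\subset\mathbb{Z}^d$ finite and $A_i\subset\mathbb{Z}^d$ an affine semigroup. -}

module Defs where

open import Level using (Level; _⊔_; suc; 0ℓ)
open import Data.Nat using (ℕ)
open import Data.Integer using (ℤ; _+_; _*_; +_; 0ℤ)
open import Data.Vec using (Vec; zipWith; replicate; map)
open import Data.List using (List; []; _∷_)
open import Data.List.Membership.Propositional using (_∈_)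
open import Data.Fin using (Fin)
open import Data.Product using (Σ; ∃; ∃-syntax; _×_; _,_)
open import Relation.Nullary using (¬_)
open import Relation.Binary.PropositionalEquality using (_≡_)

Point : ℕ → Set
Point d = Vec ℤ d

Subset : ℕ → Set₁
Subset d = Point d → Set

_⊕_ : ∀ {d} → Point d → Point d → Point d
_⊕_ = zipWith _+_

_·_ : ∀ {d} → ℕ → Point d → Point d
n · v = map (λ z → (+ n) * z) v

𝟎 : ∀ {d} → Point d
𝟎 = replicate _ 0ℤ

lincomb : ∀ {d} → (gs : List (Point d)) → (ℕ → ℕ) → Point d
lincomb [] c = 𝟎
lincomb (g ∷ gs) c = (c 0 · g) ⊕ lincomb gs (λ i → c (ℕ.suc i))

AffSemigroup : ∀ {d} → List (Point d) → Subset d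
AffSemigroup gs x = ∃[ c ] x ≡ lincomb gs c

Translate : ∀ {d} → List (Point d) → List (Point d) → Subset d
Translate F gs x = ∃[ f ] ∃[ a ] (f ∈ F × AffSemigroup gs a × x ≡ f ⊕ a)

record Piece (d : ℕ) : Set where
  constructor piece
  field
    fin  : List (Point d)
    gens : List (Point d)

⟦_⟧ : ∀ {d} → Piece d → Subset d
⟦ piece F gs ⟧ = Translate F gs

record AffineStratification {d : ℕ} (W : Subset d) : Set where
  field
    r        : ℕ
    pieces   : Fin r → Piece d
    covers   : ∀ x → W x → ∃[ i ] ⟦ pieces i ⟧ x
    inside   : ∀ i x → ⟦ pieces i ⟧ x → W x
    disjoint : ∀ i j x → ⟦ pieces i ⟧ x → ⟦ pieces j ⟧ x → i ≡ j

_⊆_ : ∀ {d} → Subset d → Subset d → Set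
A ⊆ B = ∀ x → A x → B x

_∖_ : ∀ {d} → Subset d → Subset d → Subset d
(A ∖ B) x = A x × ¬ B x

-- Call a subset of ℤ^d Presburger if it is decidable and membership of x depends only on the signs of finitely
-- many affine forms at x and on x modulo some m. Such sets are closed under difference and finite union, and,
-- by Cooper's elimination of one quantifier over ℕ, under S ↦ S + ℕ g; so affinely stratified sets are
-- Presburger, and so is A ∖ B. Conversely, ℤ^d is a finite disjoint union of boxes f + ℕ g₁ + … + ℕ g_d with
-- independent gᵢ ∈ m ℤ^d. Each cell of this kind splits, by disjoint cuts of its coordinate monoid ℕ^k, into
-- finitely many free cells on which all the forms have constant sign; such a cell lies inside or outside A ∖ B.

module Submission where

open import Defs
open import Data.Bool using (Bool; true; false; not)
import Data.Bool.Properties as Bool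
open import Data.Empty using (⊥)
open import Data.Fin using (Fin; zero; suc; toℕ; splitAt; _↑ˡ_; _↑ʳ_)
import Data.Fin.Properties as Fin
open import Data.Integer using (ℤ; +_; -[1+_]; +[1+_]; 0ℤ; 1ℤ; -1ℤ; ∣_∣; -_; _⊖_)
  renaming (_+_ to _+ℤ_; _*_ to _*ℤ_)
import Data.Integer.Properties as ℤ
open import Data.Integer.Tactic.RingSolver using (solve-∀)
open import Data.List as List using (List; []; _∷_; _++_; upTo)
open import Data.List.Membership.Propositional using (_∈_; lose; find)
open import Data.List.Membership.Propositional.Properties using (∈-upTo⁺; ∈-++⁺ˡ; ∈-++⁺ʳ; ∈-map⁺; ∈-allFin)
open import Data.List.Relation.Unary.All as All using (All; []; _∷_)
import Data.List.Relation.Unary.All.Properties as All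
open import Data.List.Relation.Unary.Any as Any using (Any; here)
open import Data.Nat as ℕ using (ℕ; NonZero; zero; suc)
open import Data.Nat.DivMod using (_%_; _divMod_; result; [m+kn]%n≡m%n; m<n⇒m%n≡m)
open import Data.Nat.Induction using (<-rec)
import Data.Nat.Properties as ℕ
open import Data.Product using (Σ; ∃; _×_; _,_; proj₁; proj₂)
open import Data.Sum using (_⊎_; inj₁; inj₂; [_,_]′)
open import Data.Sum.Properties using (inj₁-injective; inj₂-injective)
open import Data.Unit using (⊤; tt)
open import Data.Vec as Vec using (Vec; []; _∷_; lookup; tabulate; zipWith; insertAt; removeAt; toList)
import Data.Vec.Properties as Vec
open import Data.Vec.Relation.Unary.All as AllV using () renaming (All to AllV; [] to []; _∷_ to _∷_)
import Data.Vec.Relation.Unary.All.Properties as AllV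
open import Function using (_∘_)
open import Relation.Nullary using (¬_; contradiction; Dec; yes; no; ¬?; _×-dec_; _⊎-dec_; map′)
open import Relation.Binary.PropositionalEquality
open ≡-Reasoning

-- The pieces of A and B may have dependent generators and overlapping translates, so B cannot be
-- removed from A generator by generator. Signs and residues forget the generators, and the price is
-- that new ones must be built. Cutting in coordinates rather than in ℤ^d keeps this exact: a cut of
-- ℕ^k is a bijection between tuples of naturals, and injectivity of the parametrisation carries
-- disjointness over to ℤ^d.
--
-- Inside a box all points are congruent mod m, so only signs remain there, and the forms can be
-- treated one at a time. If the slopes of a form along the generators all have one sign, peeling
-- off generators finitely often makes its sign constant. The obstacle is a form with slopes of both
-- signs. There a cell is cut along the sum of two rescaled generators on which the form does not
-- vary, and the number of generators with nonzero slope falls.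
--
-- Decidability is part of the notion because each final cell has to be assigned constructively to
-- the inside or the outside.

private variable
  d k : ℕ

-- Vector arithmetic in ℤ^d

infixr 21 _•_

_•_ : ℤ → Point d → Point d
z • v = Vec.map (z *ℤ_) v

⊕-identityʳ : (u : Point d) → u ⊕ 𝟎 ≡ u
⊕-identityʳ [] = refl
⊕-identityʳ (x ∷ u) = cong₂ _∷_ (ℤ.+-identityʳ x) (⊕-identityʳ u)

⊕-assoc : (u v w : Point d) → (u ⊕ v) ⊕ w ≡ u ⊕ (v ⊕ w)
⊕-assoc [] [] [] = refl
⊕-assoc (x ∷ u) (y ∷ v) (z ∷ w) = cong₂ _∷_ (ℤ.+-assoc x y z) (⊕-assoc u v w)

⊕-comm : (u v : Point d) → u ⊕ v ≡ v ⊕ u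
⊕-comm [] [] = refl
⊕-comm (x ∷ u) (y ∷ v) = cong₂ _∷_ (ℤ.+-comm x y) (⊕-comm u v)

⊕-swap : (u v w : Point d) → u ⊕ (v ⊕ w) ≡ v ⊕ (u ⊕ w)
⊕-swap u v w = trans (sym (⊕-assoc u v w)) (trans (cong (_⊕ w) (⊕-comm u v)) (⊕-assoc v u w))

•-zeroˡ : (u : Point d) → 0ℤ • u ≡ 𝟎
•-zeroˡ [] = refl
•-zeroˡ (x ∷ u) = cong₂ _∷_ refl (•-zeroˡ u)

⊕-•-cancel : ∀ z (u g : Point d) → (u ⊕ z • g) ⊕ (- z) • g ≡ u
⊕-•-cancel z [] [] = refl
⊕-•-cancel z (x ∷ u) (y ∷ g) = cong₂ _∷_ (pointwise z x y) (⊕-•-cancel z u g)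
  where
  pointwise : ∀ z x y → x +ℤ z *ℤ y +ℤ (- z) *ℤ y ≡ x
  pointwise = solve-∀

-- Stratifications of finite disjoint unions

AffineStratification-≐ : {U V : Subset d} → (∀ x → U x → V x) → (∀ x → V x → U x) →
  AffineStratification U → AffineStratification V
AffineStratification-≐ U⊆V V⊆U S = record
  { pieces   = S.pieces
  ; covers   = λ x → S.covers x ∘ V⊆U x
  ; inside   = λ i x → U⊆V x ∘ S.inside i x
  ; disjoint = S.disjoint
  } where module S = AffineStratification S

∅-stratification : {W : Subset d} → (∀ x → ¬ W x) → AffineStratification W
∅-stratification empty = record
  { r        = 0
  ; pieces   = λ ()
  ; covers   = λ x w → contradiction w (empty x)
  ; inside   = λ ()
  ; disjoint = λ ()
  }

piece-stratification : (p : Piece d) → AffineStratification ⟦ p ⟧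
piece-stratification p = record
  { r        = 1
  ; pieces   = λ _ → p
  ; covers   = λ _ → zero ,_
  ; inside   = λ _ _ w → w
  ; disjoint = λ { zero zero _ _ _ → refl }
  }

⊎-stratification : {U V : Subset d} → (∀ x → U x → V x → ⊥) →
  AffineStratification U → AffineStratification V → AffineStratification (λ x → U x ⊎ V x)
⊎-stratification {d} {U} {V} apart S T = record
  { pieces   = pieces
  ; covers   = λ { x (inj₁ u) → let i , x∈ = S.covers x u in i ↑ˡ T.r , covˡ i x∈
                 ; x (inj₂ v) → let j , x∈ = T.covers x v in S.r ↑ʳ j , covʳ j x∈ }
  ; inside   = inside
  ; disjoint = disjoint
  }
  where
  module S = AffineStratification S
  module T = AffineStratification T
  pieces : Fin (S.r ℕ.+ T.r) → Piece d
  pieces i = [ S.pieces , T.pieces ]′ (splitAt S.r i)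
  covˡ : ∀ {x} i → ⟦ S.pieces i ⟧ x → ⟦ pieces (i ↑ˡ T.r) ⟧ x
  covˡ i x∈ rewrite Fin.splitAt-↑ˡ S.r i T.r = x∈
  covʳ : ∀ {x} j → ⟦ T.pieces j ⟧ x → ⟦ pieces (S.r ↑ʳ j) ⟧ x
  covʳ j x∈ rewrite Fin.splitAt-↑ʳ S.r T.r j = x∈
  inside : ∀ i x → ⟦ pieces i ⟧ x → U x ⊎ V x
  inside i x x∈ with splitAt S.r i
  ... | inj₁ i′ = inj₁ (S.inside i′ x x∈)
  ... | inj₂ j′ = inj₂ (T.inside j′ x x∈)
  disjoint : ∀ i j x → ⟦ pieces i ⟧ x → ⟦ pieces j ⟧ x → i ≡ j
  disjoint i j x x∈i x∈j with splitAt S.r i in eqi | splitAt S.r j in eqj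
  ... | inj₁ i′ | inj₁ j′ = trans (sym (Fin.splitAt⁻¹-↑ˡ eqi)) (trans (cong (_↑ˡ T.r) (S.disjoint i′ j′ x x∈i x∈j)) (Fin.splitAt⁻¹-↑ˡ eqj))
  ... | inj₁ i′ | inj₂ j′ = contradiction (T.inside j′ x x∈j) (apart x (S.inside i′ x x∈i))
  ... | inj₂ i′ | inj₁ j′ = contradiction (T.inside i′ x x∈i) (apart x (S.inside j′ x x∈j))
  ... | inj₂ i′ | inj₂ j′ = trans (sym (Fin.splitAt⁻¹-↑ʳ eqi)) (trans (cong (S.r ↑ʳ_) (T.disjoint i′ j′ x x∈i x∈j)) (Fin.splitAt⁻¹-↑ʳ eqj))

-- Stands in for finiteness of `L`, recording only the consequence that is used. Sums, products and
-- vectors of index types then need no numbering by `Fin`.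
record Summable (L : Set) : Set₁ where
  field
    ⋃-stratification : (V : L → Subset d) → (∀ {l l′ x} → V l x → V l′ x → l ≡ l′) →
      (∀ l → AffineStratification (V l)) → AffineStratification (λ x → ∃ λ l → V l x)

⊤-summable : Summable ⊤
⊤-summable .Summable.⋃-stratification V _ S =
  AffineStratification-≐ (λ _ → tt ,_) (λ _ → proj₂) (S tt)

⊎-summable : {L M : Set} → Summable L → Summable M → Summable (L ⊎ M)
⊎-summable ΣL ΣM .Summable.⋃-stratification V unique S = AffineStratification-≐
  (λ { _ (inj₁ (l , v)) → inj₁ l , v ; _ (inj₂ (m , v)) → inj₂ m , v })
  (λ { _ (inj₁ l , v) → inj₁ (l , v) ; _ (inj₂ m , v) → inj₂ (m , v) })
  (⊎-stratification (λ { _ (_ , v) (_ , v′) → contradiction (unique v v′) λ () })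
    (Summable.⋃-stratification ΣL (V ∘ inj₁) (λ v v′ → inj₁-injective (unique v v′)) (S ∘ inj₁))
    (Summable.⋃-stratification ΣM (V ∘ inj₂) (λ v v′ → inj₂-injective (unique v v′)) (S ∘ inj₂)))

×-summable : {L M : Set} → Summable L → Summable M → Summable (L × M)
×-summable ΣL ΣM .Summable.⋃-stratification V unique S = AffineStratification-≐
  (λ { _ (l , m , v) → (l , m) , v }) (λ { _ ((l , m) , v) → l , m , v })
  (Summable.⋃-stratification ΣL (λ l x → ∃ λ m → V (l , m) x)
    (λ { (_ , v) (_ , v′) → cong proj₁ (unique v v′) })
    (λ l → Summable.⋃-stratification ΣM (λ m → V (l , m)) (λ v v′ → cong proj₂ (unique v v′)) (λ m → S (l , m))))

↔-summable : {L M : Set} (to : L → M) (from : M → L) → (∀ l → from (to l) ≡ l) → (∀ m → to (from m) ≡ m) →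
  Summable L → Summable M
↔-summable to from from-to to-from ΣL .Summable.⋃-stratification V unique S = AffineStratification-≐
  (λ { _ (l , v) → to l , v })
  (λ { x (m , v) → from m , subst (λ m → V m x) (sym (to-from m)) v })
  (Summable.⋃-stratification ΣL (V ∘ to)
    (λ {l} {l′} v v′ → trans (sym (from-to l)) (trans (cong from (unique v v′)) (from-to l′)))
    (S ∘ to))

Fin-summable : ∀ n → Summable (Fin n)
Fin-summable zero .Summable.⋃-stratification V _ _ = ∅-stratification λ { _ (() , _) }
Fin-summable (suc n) = ↔-summable [ (λ _ → zero) , suc ]′
  (λ { zero → inj₁ tt ; (suc i) → inj₂ i })
  (λ { (inj₁ tt) → refl ; (inj₂ i) → refl }) (λ { zero → refl ; (suc i) → refl })
  (⊎-summable ⊤-summable (Fin-summable n))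

Vec-summable : {L : Set} → Summable L → ∀ n → Summable (Vec L n)
Vec-summable ΣL zero = ↔-summable (λ _ → []) (λ _ → tt) (λ _ → refl) (λ { [] → refl }) ⊤-summable
Vec-summable ΣL (suc n) = ↔-summable (λ { (l , σ) → l ∷ σ }) (λ { (l ∷ σ) → l , σ })
  (λ _ → refl) (λ { (_ ∷ _) → refl }) (×-summable ΣL (Vec-summable ΣL n))

-- Presburger sets and quantifier elimination

-- `slope` is the linear part of `at`. A form is given by functions and their identities, not by
-- coefficients, so combining forms comes down to ring identities.
record Form (d : ℕ) : Set where
  field
    at slope : Point d → ℤ
    at-⊕     : ∀ x v → at (x ⊕ v) ≡ at x +ℤ slope v
    slope-⊕  : ∀ u v → slope (u ⊕ v) ≡ slope u +ℤ slope v
    slope-•  : ∀ z v → slope (z • v) ≡ z *ℤ slope v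

open Form

at-shift : (ℓ : Form d) → ∀ x z v → at ℓ (x ⊕ z • v) ≡ at ℓ x +ℤ z *ℤ slope ℓ v
at-shift ℓ x z v = trans (at-⊕ ℓ x (z • v)) (cong (at ℓ x +ℤ_) (slope-• ℓ z v))

constant : ℤ → Form d
constant z = record
  { at      = λ _ → z
  ; slope   = λ _ → 0ℤ
  ; at-⊕    = λ _ _ → sym (ℤ.+-identityʳ z)
  ; slope-⊕ = λ _ _ → refl
  ; slope-• = λ z _ → sym (ℤ.*-zeroʳ z)
  }

coordinate : Fin d → Form d
coordinate i = record
  { at      = λ x → lookup x i
  ; slope   = λ v → lookup v i
  ; at-⊕    = λ x v → Vec.lookup-zipWith _+ℤ_ i x v
  ; slope-⊕ = λ u v → Vec.lookup-zipWith _+ℤ_ i u v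
  ; slope-• = λ z v → Vec.lookup-map i (z *ℤ_) v
  }

linear : ℤ → Form d → ℤ → Form d → Form d
linear p ℓ q ℓ′ = record
  { at      = λ x → p *ℤ at ℓ x +ℤ q *ℤ at ℓ′ x
  ; slope   = λ v → p *ℤ slope ℓ v +ℤ q *ℤ slope ℓ′ v
  ; at-⊕    = λ x v → trans (cong₂ (λ s t → p *ℤ s +ℤ q *ℤ t) (at-⊕ ℓ x v) (at-⊕ ℓ′ x v)) (additive p q _ _ _ _)
  ; slope-⊕ = λ u v → trans (cong₂ (λ s t → p *ℤ s +ℤ q *ℤ t) (slope-⊕ ℓ u v) (slope-⊕ ℓ′ u v)) (additive p q _ _ _ _)
  ; slope-• = λ z v → trans (cong₂ (λ s t → p *ℤ s +ℤ q *ℤ t) (slope-• ℓ z v) (slope-• ℓ′ z v)) (homogeneous p q z _ _)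
  }
  where
  additive : ∀ p q a b c e → p *ℤ (a +ℤ b) +ℤ q *ℤ (c +ℤ e) ≡ p *ℤ a +ℤ q *ℤ c +ℤ (p *ℤ b +ℤ q *ℤ e)
  additive = solve-∀
  homogeneous : ∀ p q z a b → p *ℤ (z *ℤ a) +ℤ q *ℤ (z *ℤ b) ≡ z *ℤ (p *ℤ a +ℤ q *ℤ b)
  homogeneous = solve-∀

-- Signs are two-valued, with zero counted as nonnegative; an equation is expressed by a form
-- together with its negative.
nonneg : ℤ → Bool
nonneg (+ _)    = true
nonneg -[1+ _ ] = false

nonneg⇒≡+ : ∀ {z} → nonneg z ≡ true → ∃ λ n → z ≡ + n
nonneg⇒≡+ {+ n} _ = n , refl

nonneg-square : ∀ D z → D ≢ 0ℤ → nonneg (D *ℤ D *ℤ z) ≡ nonneg z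
nonneg-square (+ zero) z D≢0 = contradiction refl D≢0
nonneg-square +[1+ m ] (+ n) _ rewrite sym (ℤ.pos-* (suc m ℕ.* suc m) n) = refl
nonneg-square +[1+ m ] -[1+ n ] _ = refl
nonneg-square -[1+ m ] (+ n) _ rewrite sym (ℤ.pos-* (suc m ℕ.* suc m) n) = refl
nonneg-square -[1+ m ] -[1+ n ] _ = refl

nonneg-antisym : ∀ z → nonneg z ≡ true → nonneg (- z) ≡ true → z ≡ 0ℤ
nonneg-antisym (+ zero) _ _ = refl

nonneg-⊖ : ∀ {m n} → m ℕ.< n → nonneg (m ⊖ n) ≡ false
nonneg-⊖ m<n rewrite ℤ.⊖-< m<n = negative (ℕ.m<n⇒0<n∸m m<n)
  where
  negative : ∀ {k} → 0 ℕ.< k → nonneg (- + k) ≡ false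
  negative (ℕ.s≤s _) = refl

-- A step across zero is at least as long as the distance to zero. This leaves only finitely many
-- values of a form to consider in `ray-presburger`.
sign-change-bound : ∀ v w → nonneg v ≢ nonneg (v +ℤ w) → ∣ v ∣ ℕ.≤ ∣ w ∣
sign-change-bound (+ n) (+ k) change = contradiction refl change
sign-change-bound -[1+ n ] -[1+ k ] change = contradiction refl change
sign-change-bound (+ n) -[1+ k ] change with suc k ℕ.≤? n
... | yes k<n rewrite ℤ.⊖-≥ k<n = contradiction refl change
... | no  k≮n = ℕ.<⇒≤ (ℕ.≰⇒> k≮n)
sign-change-bound -[1+ n ] (+ k) change with suc n ℕ.≤? k
... | yes n<k = n<k
... | no  n≮k = contradiction (sym (nonneg-⊖ (ℕ.≰⇒> n≮k))) change

∣D∣²≡D² : ∀ D → + (∣ D ∣ ℕ.* ∣ D ∣) ≡ D *ℤ D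
∣D∣²≡D² (+ n)    = ℤ.pos-* n n
∣D∣²≡D² -[1+ n ] = refl

SameSigns : List (Form d) → Point d → Point d → Set
SameSigns ℓs x y = All (λ ℓ → nonneg (at ℓ x) ≡ nonneg (at ℓ y)) ℓs

Congruent : ℕ → Point d → Point d → Set
Congruent m x y = ∃ λ v → y ≡ x ⊕ (+ m) • v

Congruent-*ˡ : ∀ m n {x y : Point d} → Congruent (m ℕ.* n) x y → Congruent m x y
Congruent-*ˡ m n (v , refl) = (+ n) • v , cong (_ ⊕_) (assoc v)
  where
  assoc : ∀ {d} (v : Point d) → (+ (m ℕ.* n)) • v ≡ (+ m) • (+ n) • v
  assoc [] = refl
  assoc (x ∷ v) = cong₂ _∷_ (trans (cong (_*ℤ x) (ℤ.pos-* m n)) (ℤ.*-assoc (+ m) (+ n) x)) (assoc v)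

Congruent-*ʳ : ∀ m n {x y : Point d} → Congruent (m ℕ.* n) x y → Congruent n x y
Congruent-*ʳ m n {x} {y} = Congruent-*ˡ n m ∘ subst (λ k → Congruent k x y) (ℕ.*-comm m n)

Congruent-sym : ∀ m {x y : Point d} → Congruent m x y → Congruent m y x
Congruent-sym m {x} (v , refl) = -1ℤ • v , lemma x v
  where
  pointwise : ∀ m x v → x ≡ x +ℤ m *ℤ v +ℤ m *ℤ (-1ℤ *ℤ v)
  pointwise = solve-∀
  lemma : ∀ {d} (x v : Point d) → x ≡ (x ⊕ (+ m) • v) ⊕ (+ m) • -1ℤ • v
  lemma [] [] = refl
  lemma (x ∷ xs) (v ∷ vs) = cong₂ _∷_ (pointwise (+ m) x v) (lemma xs vs)

-- One implication in `determined` is enough: both of its hypotheses are symmetric in x and y, so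
-- non-membership is transferred as well, as `∖-presburger` requires.
record Presburger (W : Subset d) : Set where
  field
    dec         : ∀ x → Dec (W x)
    forms       : List (Form d)
    modulus     : ℕ
    {{nonZero}} : NonZero modulus
    determined  : ∀ {x y} → SameSigns forms x y → Congruent modulus x y → W x → W y

Presburger-≐ : {U V : Subset d} → (∀ x → U x → V x) → (∀ x → V x → U x) → Presburger U → Presburger V
Presburger-≐ U⊆V V⊆U P = record
  { dec        = λ x → map′ (U⊆V x) (V⊆U x) (dec x)
  ; forms      = forms
  ; modulus    = modulus
  ; determined = λ same x≡y → U⊆V _ ∘ determined same x≡y ∘ V⊆U _
  } where open Presburger P

∅-presburger : {W : Subset d} → (∀ x → ¬ W x) → Presburger W
∅-presburger empty = record
  { dec = λ x → no (empty x) ; forms = [] ; modulus = 1 ; determined = λ _ _ w → contradiction w (empty _) }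

module _ {U V : Subset d} (P : Presburger U) (Q : Presburger V) where
  private
    module P = Presburger P
    module Q = Presburger Q
    instance
      product≢0 : NonZero (P.modulus ℕ.* Q.modulus)
      product≢0 = ℕ.m*n≢0 P.modulus Q.modulus

  ⊎-presburger : Presburger (λ x → U x ⊎ V x)
  ⊎-presburger = record
    { dec        = λ x → P.dec x ⊎-dec Q.dec x
    ; forms      = P.forms ++ Q.forms
    ; modulus    = P.modulus ℕ.* Q.modulus
    ; determined = λ { same x≡y (inj₁ u) → inj₁ (P.determined (All.++⁻ˡ P.forms same) (Congruent-*ˡ P.modulus Q.modulus x≡y) u)
                     ; same x≡y (inj₂ v) → inj₂ (Q.determined (All.++⁻ʳ P.forms same) (Congruent-*ʳ P.modulus Q.modulus x≡y) v) }
    }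

  ∖-presburger : Presburger (U ∖ V)
  ∖-presburger = record
    { dec        = λ x → P.dec x ×-dec ¬? (Q.dec x)
    ; forms      = P.forms ++ Q.forms
    ; modulus    = P.modulus ℕ.* Q.modulus
    ; determined = λ { same x≡y (u , ¬v) → P.determined (All.++⁻ˡ P.forms same) (Congruent-*ˡ P.modulus Q.modulus x≡y) u ,
        ¬v ∘ Q.determined (All.map sym (All.++⁻ʳ P.forms same)) (Congruent-sym Q.modulus (Congruent-*ʳ P.modulus Q.modulus x≡y)) }
    }

⋃-presburger : {A : Set} {V : A → Subset d} → (∀ a → Presburger (V a)) →
  (as : List A) → Presburger (λ x → Any (λ a → V a x) as)
⋃-presburger P [] = ∅-presburger λ _ ()
⋃-presburger P (a ∷ as) = Presburger-≐ (λ _ → Any.fromSum) (λ _ → Any.toSum) (⊎-presburger (P a) (⋃-presburger P as))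

-- The second argument may use the condition, as it must for `quotient-shift-presburger`, which asks
-- for a nonzero divisor.
×-presburger : {P : Set} {V : Subset d} → Dec P → (P → Presburger V) → Presburger (λ x → P × V x)
×-presburger (yes p) Q = Presburger-≐ (λ _ → p ,_) (λ _ → proj₂) (Q p)
×-presburger (no ¬p) Q = ∅-presburger λ _ → ¬p ∘ proj₁

lookup-injective : ∀ {A : Set} {n} (u v : Vec A n) → (∀ i → lookup u i ≡ lookup v i) → u ≡ v
lookup-injective u v eq = begin
  u                   ≡⟨ Vec.tabulate∘lookup u ⟨
  tabulate (lookup u) ≡⟨ Vec.tabulate-cong eq ⟩
  tabulate (lookup v) ≡⟨ Vec.tabulate∘lookup v ⟩
  v                   ∎

-- At p the forms x_i - p_i and p_i - x_i vanish and so count as nonnegative; where both are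
-- nonnegative, x_i = p_i.
singleton-presburger : (p : Point d) → Presburger (_≡ p)
singleton-presburger {d} p = record
  { dec        = λ x → Vec.≡-dec ℤ._≟_ x p
  ; forms      = List.tabulate (difference 1ℤ -1ℤ) ++ List.tabulate (difference -1ℤ 1ℤ)
  ; modulus    = 1
  ; determined = λ { {y = y} same _ refl → lookup-injective y p λ i → equal (lookup p i) (lookup y i)
      (All.tabulate⁻ (All.++⁻ˡ (List.tabulate (difference 1ℤ -1ℤ)) same) i)
      (All.tabulate⁻ (All.++⁻ʳ (List.tabulate (difference 1ℤ -1ℤ)) same) i) }
  }
  where
  difference : ℤ → ℤ → Fin d → Form d
  difference s t i = linear s (coordinate i) t (constant (lookup p i))
  zeroˡ : ∀ a → 1ℤ *ℤ a +ℤ -1ℤ *ℤ a ≡ 0ℤ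
  zeroˡ = solve-∀
  zeroʳ : ∀ a → -1ℤ *ℤ a +ℤ 1ℤ *ℤ a ≡ 0ℤ
  zeroʳ = solve-∀
  neg : ∀ a b → -1ℤ *ℤ a +ℤ 1ℤ *ℤ b ≡ - (1ℤ *ℤ a +ℤ -1ℤ *ℤ b)
  neg = solve-∀
  add-back : ∀ a b → b ≡ (1ℤ *ℤ b +ℤ -1ℤ *ℤ a) +ℤ a
  add-back = solve-∀
  equal : ∀ a b → nonneg (1ℤ *ℤ a +ℤ -1ℤ *ℤ a) ≡ nonneg (1ℤ *ℤ b +ℤ -1ℤ *ℤ a) →
    nonneg (-1ℤ *ℤ a +ℤ 1ℤ *ℤ a) ≡ nonneg (-1ℤ *ℤ b +ℤ 1ℤ *ℤ a) → b ≡ a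
  equal a b p q rewrite zeroˡ a | zeroʳ a | neg b a = begin
    b                                ≡⟨ add-back a b ⟩
    (1ℤ *ℤ b +ℤ -1ℤ *ℤ a) +ℤ a       ≡⟨ cong (_+ℤ a) (nonneg-antisym _ (sym p) (sym q)) ⟩
    0ℤ +ℤ a                          ≡⟨ ℤ.+-identityˡ a ⟩
    a                                ∎

-- Elimination of a quantifier along a ray

module _ {S : Subset d} (P : Presburger S) (g : Point d) where
  private module P = Presburger P

  -- Translation by a quotient N(x)/D; clearing denominators with D² > 0 spares a case split on the sign of D.
  quotient-shift-presburger : (N : Form d) (D : ℤ) → D ≢ 0ℤ →
    Presburger (λ x → ∃ λ t → D *ℤ + t ≡ at N x × S (x ⊕ (- + t) • g))
  quotient-shift-presburger N D D≢0 = record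
    { dec        = λ x → map′ (λ { (t , _ , w) → t , w }) (λ { (t , eq , s) → t , ℕ.s≤s (bound eq) , eq , s })
        (ℕ.anyUpTo? (λ t → (D *ℤ + t ℤ.≟ at N x) ×-dec P.dec (x ⊕ (- + t) • g)) (suc ∣ at N x ∣))
    -- The first form is D N(x) = D² t; it has the sign of t and keeps the quotient a natural
    -- number.
    ; forms      = linear D N 0ℤ N ∷ List.map cleared P.forms
    -- With m the modulus of S, moving x by m D² w changes t by the integer m D σ, where σ is the
    -- slope of N at w, and moves x - t g by a multiple of m.
    ; modulus    = P.modulus ℕ.* (∣ D ∣ ℕ.* ∣ D ∣)
    ; determined = determined
    }
    where
    instance
      ∣D∣≢0 : NonZero ∣ D ∣
      ∣D∣≢0 = ℕ.≢-nonZero (D≢0 ∘ ℤ.∣i∣≡0⇒i≡0)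
      ∣D∣²≢0 : NonZero (∣ D ∣ ℕ.* ∣ D ∣)
      ∣D∣²≢0 = ℕ.m*n≢0 ∣ D ∣ ∣ D ∣
      modulus≢0 : NonZero (P.modulus ℕ.* (∣ D ∣ ℕ.* ∣ D ∣))
      modulus≢0 = ℕ.m*n≢0 P.modulus (∣ D ∣ ℕ.* ∣ D ∣)

    bound : ∀ {t z} → D *ℤ + t ≡ z → t ℕ.≤ ∣ z ∣
    bound {t} refl = subst (t ℕ.≤_) (sym (ℤ.abs-* D (+ t))) (ℕ.m≤n*m t ∣ D ∣)

    -- D² ℓ(x - t g), with D t replaced by N(x) so that t disappears.
    cleared : Form d → Form d
    cleared ℓ = linear (D *ℤ D) ℓ (- (D *ℤ slope ℓ g)) N

    clear : ∀ D a t s → D *ℤ D *ℤ (a +ℤ - t *ℤ s) ≡ D *ℤ D *ℤ a +ℤ - (D *ℤ s) *ℤ (D *ℤ t)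
    clear = solve-∀

    sign-cleared : ∀ ℓ x t → D *ℤ t ≡ at N x → nonneg (at ℓ (x ⊕ (- t) • g)) ≡ nonneg (at (cleared ℓ) x)
    sign-cleared ℓ x t eq = begin
      nonneg (at ℓ (x ⊕ (- t) • g))                       ≡⟨ nonneg-square D _ D≢0 ⟨
      nonneg (D *ℤ D *ℤ at ℓ (x ⊕ (- t) • g))             ≡⟨ cong (λ z → nonneg (D *ℤ D *ℤ z)) (at-shift ℓ x (- t) g) ⟩
      nonneg (D *ℤ D *ℤ (at ℓ x +ℤ - t *ℤ slope ℓ g))     ≡⟨ cong nonneg (clear D (at ℓ x) t (slope ℓ g)) ⟩
      nonneg (D *ℤ D *ℤ at ℓ x +ℤ - (D *ℤ slope ℓ g) *ℤ (D *ℤ t)) ≡⟨ cong (λ n → nonneg (D *ℤ D *ℤ at ℓ x +ℤ - (D *ℤ slope ℓ g) *ℤ n)) eq ⟩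
      nonneg (at (cleared ℓ) x)                           ∎

    D²t : ∀ D t → D *ℤ (D *ℤ t) +ℤ 0ℤ *ℤ (D *ℤ t) ≡ D *ℤ D *ℤ t
    D²t = solve-∀

    sign-quotient : ∀ x t → D *ℤ t ≡ at N x → nonneg t ≡ nonneg (at (linear D N 0ℤ N) x)
    sign-quotient x t eq = begin
      nonneg t                                    ≡⟨ nonneg-square D t D≢0 ⟨
      nonneg (D *ℤ D *ℤ t)                        ≡⟨ cong nonneg (D²t D t) ⟨
      nonneg (D *ℤ (D *ℤ t) +ℤ 0ℤ *ℤ (D *ℤ t))    ≡⟨ cong (λ n → nonneg (D *ℤ n +ℤ 0ℤ *ℤ n)) eq ⟩
      nonneg (at (linear D N 0ℤ N) x)             ∎

    modulus-ℤ : + (P.modulus ℕ.* (∣ D ∣ ℕ.* ∣ D ∣)) ≡ + P.modulus *ℤ (D *ℤ D)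
    modulus-ℤ = trans (ℤ.pos-* P.modulus _) (cong (+ P.modulus *ℤ_) (∣D∣²≡D² D))

    distribute : ∀ D t m s → D *ℤ (t +ℤ m *ℤ D *ℤ s) ≡ D *ℤ t +ℤ m *ℤ (D *ℤ D) *ℤ s
    distribute = solve-∀

    regroup : ∀ m s t {d} (x w g : Point d) → (x ⊕ (m *ℤ (D *ℤ D)) • w) ⊕ (- (t +ℤ m *ℤ D *ℤ s)) • g
      ≡ (x ⊕ (- t) • g) ⊕ m • ((D *ℤ D) • w ⊕ (- (D *ℤ s)) • g)
    regroup m s t [] [] [] = refl
    regroup m s t (x ∷ xs) (w ∷ ws) (g ∷ gs) = cong₂ _∷_ (pointwise m s t D x w g) (regroup m s t xs ws gs)
      where
      pointwise : ∀ m s t D x w g → x +ℤ m *ℤ (D *ℤ D) *ℤ w +ℤ (- (t +ℤ m *ℤ D *ℤ s)) *ℤ g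
        ≡ x +ℤ - t *ℤ g +ℤ m *ℤ (D *ℤ D *ℤ w +ℤ - (D *ℤ s) *ℤ g)
      pointwise = solve-∀

    determined : ∀ {x y} → SameSigns (linear D N 0ℤ N ∷ List.map cleared P.forms) x y →
      Congruent (P.modulus ℕ.* (∣ D ∣ ℕ.* ∣ D ∣)) x y →
      (∃ λ t → D *ℤ + t ≡ at N x × S (x ⊕ (- + t) • g)) → ∃ λ t → D *ℤ + t ≡ at N y × S (y ⊕ (- + t) • g)
    determined {x} {y} (same₀ ∷ same) (w , y≡) (t , Dt≡ , s) = transfer (nonneg⇒≡+ u-nonneg)
      where
      m σ u : ℤ
      m = + P.modulus
      σ = slope N w
      -- The quotient N(y)/D, an integer by the choice of the modulus; `same₀` then makes it a
      -- natural number.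
      u = + t +ℤ m *ℤ D *ℤ σ
      y≡′ : y ≡ x ⊕ (m *ℤ (D *ℤ D)) • w
      y≡′ = trans y≡ (cong (λ k → x ⊕ k • w) modulus-ℤ)
      Du≡ : D *ℤ u ≡ at N y
      Du≡ = begin
        D *ℤ u                                   ≡⟨ distribute D (+ t) m σ ⟩
        D *ℤ + t +ℤ m *ℤ (D *ℤ D) *ℤ σ           ≡⟨ cong₂ _+ℤ_ Dt≡ (sym (slope-• N (m *ℤ (D *ℤ D)) w)) ⟩
        at N x +ℤ slope N ((m *ℤ (D *ℤ D)) • w)  ≡⟨ at-⊕ N x _ ⟨
        at N (x ⊕ (m *ℤ (D *ℤ D)) • w)           ≡⟨ cong (at N) y≡′ ⟨
        at N y                                   ∎
      u-nonneg : nonneg u ≡ true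
      u-nonneg = trans (sign-quotient y u Du≡) (trans (sym same₀) (sym (sign-quotient x (+ t) Dt≡)))
      s′ : S (y ⊕ (- u) • g)
      s′ = P.determined
        (All.map (λ {ℓ} e → trans (sign-cleared ℓ x (+ t) Dt≡) (trans e (sym (sign-cleared ℓ y u Du≡)))) (All.map⁻ same))
        (_ , trans (cong (_⊕ (- u) • g) y≡′) (regroup m σ (+ t) x w g)) s
      transfer : (∃ λ n → u ≡ + n) → ∃ λ t → D *ℤ + t ≡ at N y × S (y ⊕ (- + t) • g)
      transfer (n , u≡n) = n , trans (cong (D *ℤ_) (sym u≡n)) Du≡ , subst (λ u → S (y ⊕ (- u) • g)) u≡n s′

  private
    interval : ℕ → List ℤ
    interval b = List.map +_ (upTo (suc b)) ++ List.map (λ n → - + n) (upTo (suc b))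

    ∈-interval : ∀ {v b} → ∣ v ∣ ℕ.≤ b → v ∈ interval b
    ∈-interval {+ n}      v≤b = ∈-++⁺ˡ (∈-map⁺ +_ (∈-upTo⁺ (ℕ.s≤s v≤b)))
    ∈-interval { -[1+ n ]} {b} v≤b = ∈-++⁺ʳ (List.map +_ (upTo (suc b))) (∈-map⁺ (λ n → - + n) (∈-upTo⁺ (ℕ.s≤s v≤b)))

  -- The least t with x − t g ∈ S is below the modulus m, or else some form changes sign between t − m and t,
  -- and then its value v at x − t g is bounded and t is determined by v.
  ray-presburger : Presburger (λ x → ∃ λ t → S (x ⊕ (- + t) • g))
  ray-presburger = Presburger-≐
    (λ { x (inj₁ c) → let _ , _ , t , _ , s = find c in t , s
       ; x (inj₂ c) → let _ , _ , _ , c′ = find c ; _ , _ , t , _ , s = find c′ in t , s })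
    (λ { x (t , s) → candidate x t s })
    (⊎-presburger
      -- A fixed t is the quotient of a constant form by 1.
      (⋃-presburger (λ t → quotient-shift-presburger (constant (+ t)) 1ℤ (λ ())) (upTo P.modulus))
      (⋃-presburger (λ ℓ → ×-presburger (¬? (slope ℓ g ℤ.≟ 0ℤ)) (λ a≢0 →
        -- With a the slope of ℓ at g, the equation ℓ(x - t g) = v reads a t = ℓ(x) - v.
        ⋃-presburger (λ v → quotient-shift-presburger (linear 1ℤ ℓ -1ℤ (constant v)) (slope ℓ g) a≢0)
          (interval ∣ + P.modulus *ℤ slope ℓ g ∣))) P.forms))
    where
    Shift : Form d → ℤ → Subset d
    Shift N D x = ∃ λ t → D *ℤ + t ≡ at N x × S (x ⊕ (- + t) • g)

    Candidate : Subset d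
    Candidate x = Any (λ t → Shift (constant (+ t)) 1ℤ x) (upTo P.modulus) ⊎
      Any (λ ℓ → slope ℓ g ≢ 0ℤ × Any (λ v → Shift (linear 1ℤ ℓ -1ℤ (constant v)) (slope ℓ g) x)
        (interval ∣ + P.modulus *ℤ slope ℓ g ∣)) P.forms

    step-back : ∀ m t {d} (x g : Point d) → x ⊕ (- t) • g ≡ (x ⊕ (- (t +ℤ m)) • g) ⊕ m • g
    step-back m t [] [] = refl
    step-back m t (x ∷ xs) (g ∷ gs) = cong₂ _∷_ (pointwise m t x g) (step-back m t xs gs)
      where
      pointwise : ∀ m t x g → x +ℤ - t *ℤ g ≡ x +ℤ - (t +ℤ m) *ℤ g +ℤ m *ℤ g
      pointwise = solve-∀

    back : ∀ {t} x → P.modulus ℕ.≤ t → x ⊕ (- + (t ℕ.∸ P.modulus)) • g ≡ (x ⊕ (- + t) • g) ⊕ (+ P.modulus) • g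
    back {t} x m≤t = trans (step-back (+ P.modulus) (+ (t ℕ.∸ P.modulus)) x g)
      (cong (λ t → (x ⊕ (- + t) • g) ⊕ (+ P.modulus) • g) (ℕ.m∸n+n≡m m≤t))

    solve-t : ∀ a t c → a *ℤ t ≡ 1ℤ *ℤ c +ℤ -1ℤ *ℤ (c +ℤ - t *ℤ a)
    solve-t = solve-∀

    candidate : ∀ x t → S (x ⊕ (- + t) • g) → Candidate x
    candidate x = <-rec _ λ t smaller s → step t smaller s
      where
      step : ∀ t → (∀ {t′} → t′ ℕ.< t → S (x ⊕ (- + t′) • g) → Candidate x) → S (x ⊕ (- + t) • g) → Candidate x
      step t smaller s with t ℕ.<? P.modulus
      ... | yes t<m = inj₁ (lose (∈-upTo⁺ t<m) (t , ℤ.*-identityˡ (+ t) , s))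
      ... | no  t≮m with All.all? (λ ℓ → nonneg (at ℓ (x ⊕ (- + t) • g)) Bool.≟ nonneg (at ℓ (x ⊕ (- + (t ℕ.∸ P.modulus)) • g))) P.forms
      -- No sign changes between t and t - m, so t - m is again a witness and the descent goes on.
      ...   | yes same = smaller (ℕ.∸-monoʳ-< (ℕ.>-nonZero⁻¹ P.modulus) (ℕ.≮⇒≥ t≮m)) (P.determined same (g , back x (ℕ.≮⇒≥ t≮m)) s)
      ...   | no ¬same = inj₂ (Any.map (λ {ℓ} → at-sign-change ℓ) (All.¬All⇒Any¬ (λ _ → _ Bool.≟ _) P.forms ¬same))
        where
        at-sign-change : ∀ ℓ → nonneg (at ℓ (x ⊕ (- + t) • g)) ≢ nonneg (at ℓ (x ⊕ (- + (t ℕ.∸ P.modulus)) • g)) →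
          slope ℓ g ≢ 0ℤ × Any (λ v → Shift (linear 1ℤ ℓ -1ℤ (constant v)) (slope ℓ g) x) (interval ∣ + P.modulus *ℤ slope ℓ g ∣)
        at-sign-change ℓ change =
          (λ a≡0 → change′ (cong nonneg (sym (trans (cong (λ a → v +ℤ + P.modulus *ℤ a) a≡0)
             (trans (cong (v +ℤ_) (ℤ.*-zeroʳ (+ P.modulus))) (ℤ.+-identityʳ v)))))) ,
          lose (∈-interval (sign-change-bound v _ change′)) (t , at-t , s)
          where
          v : ℤ
          v = at ℓ (x ⊕ (- + t) • g)
          change′ : nonneg v ≢ nonneg (v +ℤ + P.modulus *ℤ slope ℓ g)
          change′ = subst (λ z → nonneg v ≢ nonneg z)
            (trans (cong (at ℓ) (back x (ℕ.≮⇒≥ t≮m))) (at-shift ℓ _ (+ P.modulus) g)) change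
          at-t : slope ℓ g *ℤ + t ≡ 1ℤ *ℤ at ℓ x +ℤ -1ℤ *ℤ v
          at-t = trans (solve-t (slope ℓ g) (+ t) (at ℓ x))
            (cong (λ z → 1ℤ *ℤ at ℓ x +ℤ -1ℤ *ℤ z) (sym (at-shift ℓ x (- + t) g)))

-- Affinely stratified sets are Presburger

semigroup-presburger : (f : Point d) (gs : List (Point d)) → Presburger (λ x → ∃ λ c → x ≡ f ⊕ lincomb gs c)
semigroup-presburger f [] = Presburger-≐ (λ _ → (λ _ → 0) ,_) (λ _ → proj₂) (singleton-presburger (f ⊕ 𝟎))
semigroup-presburger f (g ∷ gs) = Presburger-≐
  (λ { x (t , c , x-tg≡) → (λ { zero → t ; (suc i) → c i }) , (begin
    x                                         ≡⟨ sym (cancel t x) ⟩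
    (x ⊕ (- + t) • g) ⊕ (+ t) • g             ≡⟨ cong (_⊕ (+ t) • g) x-tg≡ ⟩
    (f ⊕ lincomb gs c) ⊕ (+ t) • g            ≡⟨ ⊕-comm _ _ ⟩
    (+ t) • g ⊕ (f ⊕ lincomb gs c)            ≡⟨ ⊕-swap _ f _ ⟩
    f ⊕ ((+ t) • g ⊕ lincomb gs c)            ∎) })
  (λ { x (c , refl) → c 0 , c ∘ suc , (begin
    (f ⊕ ((+ c 0) • g ⊕ lincomb gs (c ∘ suc))) ⊕ (- + c 0) • g
      ≡⟨ cong (_⊕ (- + c 0) • g) (trans (⊕-swap f _ _) (⊕-comm _ _)) ⟩
    ((f ⊕ lincomb gs (c ∘ suc)) ⊕ (+ c 0) • g) ⊕ (- + c 0) • g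
      ≡⟨ ⊕-•-cancel (+ c 0) _ g ⟩
    f ⊕ lincomb gs (c ∘ suc) ∎) })
  (ray-presburger (semigroup-presburger f gs) g)
  where
  cancel : ∀ t x → (x ⊕ (- + t) • g) ⊕ (+ t) • g ≡ x
  cancel t x = trans (cong (λ z → (x ⊕ (- + t) • g) ⊕ z • g) (sym (ℤ.neg-involutive (+ t)))) (⊕-•-cancel (- + t) x g)

piece-presburger : (p : Piece d) → Presburger ⟦ p ⟧
piece-presburger (piece F gs) = Presburger-≐
  (λ x x∈ → let f , f∈F , c , x≡ = find {P = λ f → ∃ λ c → x ≡ f ⊕ lincomb gs c} x∈ in f , lincomb gs c , f∈F , (c , refl) , x≡)
  (λ { x (f , _ , f∈F , (c , refl) , x≡) → lose f∈F (c , x≡) })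
  (⋃-presburger (λ f → semigroup-presburger f gs) F)

stratified⇒presburger : {W : Subset d} → AffineStratification W → Presburger W
stratified⇒presburger S = Presburger-≐
  (λ x x∈ → let i , _ , x∈i = find {P = λ i → ⟦ pieces i ⟧ x} x∈ in inside i x x∈i)
  (λ x w → let i , x∈ = covers x w in lose (∈-allFin i) x∈)
  (⋃-presburger (λ i → piece-presburger (pieces i)) (List.allFin r))
  where
  open AffineStratification S

-- Subdivision of free cells

-- Coefficients form a vector of exact length, so that they can be unique. The functions in
-- `lincomb` cannot be: distinct ones may agree on the whole list.
comb : Vec (Point d) k → Vec ℕ k → Point d
comb []       []       = 𝟎
comb (g ∷ gs) (a ∷ as) = (+ a) • g ⊕ comb gs as

param : Point d → Vec (Point d) k → Vec ℕ k → Point d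
param f gs c = f ⊕ comb gs c

Cell : Point d → Vec (Point d) k → Subset d
Cell f gs x = ∃ λ c → x ≡ param f gs c

Cell⇒Translate : (f : Point d) (gs : Vec (Point d) k) → ∀ x → Cell f gs x → Translate (f ∷ []) (toList gs) x
Cell⇒Translate f gs x (c , x≡) = f , comb gs c , here refl , (coefficient c , comb≡lincomb gs c) , x≡
  where
  coefficient : ∀ {k} → Vec ℕ k → ℕ → ℕ
  coefficient []      _       = 0
  coefficient (a ∷ c) zero    = a
  coefficient (a ∷ c) (suc i) = coefficient c i
  comb≡lincomb : ∀ {k} (gs : Vec (Point _) k) c → comb gs c ≡ lincomb (toList gs) (coefficient c)
  comb≡lincomb []       []      = refl
  comb≡lincomb (g ∷ gs) (a ∷ c) = cong ((+ a) • g ⊕_) (comb≡lincomb gs c)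

Translate⇒Cell : (f : Point d) (gs : Vec (Point d) k) → ∀ x → Translate (f ∷ []) (toList gs) x → Cell f gs x
Translate⇒Cell f gs x (_ , _ , here refl , (c , refl) , x≡) = Vec.tabulate (c ∘ toℕ) , trans x≡ (cong (f ⊕_) (lincomb≡comb gs c))
  where
  lincomb≡comb : ∀ {k} (gs : Vec (Point _) k) c → lincomb (toList gs) c ≡ comb gs (Vec.tabulate (c ∘ toℕ))
  lincomb≡comb []       c = refl
  lincomb≡comb (g ∷ gs) c = cong ((+ c 0) • g ⊕_) (lincomb≡comb gs (c ∘ suc))

module _ {d} (W : Subset d) where

  -- No congruence occurs here: inside a box it holds automatically, and subdivision never leaves
  -- the box.
  record Tame (ℓs : List (Form d)) (f : Point d) (gs : Vec (Point d) k) : Set where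
    field
      free       : ∀ {c c′} → param f gs c ≡ param f gs c′ → c ≡ c′
      determined : ∀ c c′ → SameSigns ℓs (param f gs c) (param f gs c′) → W (param f gs c) → W (param f gs c′)

  Stratifies : List (Form d) → Point d → Vec (Point d) k → Set
  Stratifies ℓs f gs = Tame ℓs f gs → AffineStratification (λ x → W x × Cell f gs x)

-- A partition of ℕ^k into copies of smaller or equal free monoids. Geometry enters only through
-- `agree`. The equality of pairs in `injective` says at once that the cells are disjoint and that
-- each has unique coordinates.
record Subdivision (f : Point d) (gs : Vec (Point d) k) : Set₁ where
  field
    {Index}    : Set
    summable   : Summable Index
    size       : Index → ℕ
    base       : Index → Point d
    gens       : ∀ l → Vec (Point d) (size l)
    coords     : ∀ l → Vec ℕ (size l) → Vec ℕ k
    agree      : ∀ l c → param (base l) (gens l) c ≡ param f gs (coords l c)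
    injective  : ∀ {l l′ c c′} → coords l c ≡ coords l′ c′ → _≡_ {A = Σ Index (Vec ℕ ∘ size)} (l , c) (l′ , c′)
    surjective : ∀ c → ∃ λ l → ∃ λ c′ → coords l c′ ≡ c

-- Freeness of the parent turns equal points into equal coordinates. Then the first component of
-- `injective` separates the cells in ℤ^d, and the second makes each cell free again.
subdivide : {W : Subset d} {ℓs : List (Form d)} {f : Point d} {gs : Vec (Point d) k} (D : Subdivision f gs) →
  (∀ l → Stratifies W ℓs (Subdivision.base D l) (Subdivision.gens D l)) → Stratifies W ℓs f gs
subdivide {W = W} {ℓs} {f} {gs} D S tame = AffineStratification-≐
  (λ { x (l , w , c , x≡) → w , coords l c , trans x≡ (agree l c) })
  (λ { x (w , c , x≡) → let l , c′ , eq = surjective c in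
         l , w , c′ , trans x≡ (trans (cong (param f gs) (sym eq)) (sym (agree l c′))) })
  (Summable.⋃-stratification summable (λ l x → W x × Cell (base l) (gens l) x)
    (λ { {l} {l′} (_ , c , refl) (_ , c′ , eq) →
           cong proj₁ (injective (free (trans (sym (agree l c)) (trans eq (agree l′ c′))))) })
    (λ l → S l record
      { free       = λ {c} {c′} eq → snd (injective (free (trans (sym (agree l c)) (trans eq (agree l c′)))))
      ; determined = λ c c′ → subst₂ (λ x y → SameSigns ℓs x y → W x → W y) (sym (agree l c)) (sym (agree l c′))
          (determined (coords l c) (coords l c′))
      }))
  where
  open Subdivision D
  open Tame tame
  snd : ∀ {l c c′} → _≡_ {A = Σ Index (Vec ℕ ∘ size)} (l , c) (l , c′) → c ≡ c′
  snd refl = refl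

comb-insertAt : (gs : Vec (Point d) (suc k)) (i : Fin (suc k)) (c : Vec ℕ k) (a : ℕ) →
  comb (lookup gs i ∷ removeAt gs i) (a ∷ c) ≡ comb gs (insertAt c i a)
comb-insertAt (g ∷ gs) zero c a = refl
comb-insertAt (g ∷ gs@(_ ∷ _)) (suc i) (b ∷ c) a =
  trans (⊕-swap _ _ _) (cong ((+ b) • g ⊕_) (comb-insertAt gs i c a))

bring-to-front : (f : Point d) (gs : Vec (Point d) (suc k)) (i : Fin (suc k)) → Subdivision f gs
bring-to-front f gs i = record
  { summable   = ⊤-summable
  ; size       = λ _ → _
  ; base       = λ _ → f
  ; gens       = λ _ → lookup gs i ∷ removeAt gs i
  ; coords     = λ { _ (a ∷ c) → insertAt c i a }
  ; agree      = λ { _ (a ∷ c) → cong (f ⊕_) (comb-insertAt gs i c a) }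
  ; injective  = λ { {c = a ∷ c} {c′ = a′ ∷ c′} eq → cong (tt ,_) (cong₂ _∷_
      (trans (sym (Vec.insertAt-lookup c i a)) (trans (cong (λ v → lookup v i) eq) (Vec.insertAt-lookup c′ i a′)))
      (trans (sym (Vec.removeAt-insertAt c i a)) (trans (cong (λ v → removeAt v i) eq) (Vec.removeAt-insertAt c′ i a′)))) }
  ; surjective = λ c → tt , lookup c i ∷ removeAt c i , Vec.insertAt-removeAt c i
  }

split-off-zero : (f g : Point d) (gs : Vec (Point d) k) → Subdivision f (g ∷ gs)
split-off-zero {k = k} f g gs = record
  { Index      = Fin 2
  ; summable   = Fin-summable 2
  ; size       = λ { zero → k ; (suc _) → suc k }
  ; base       = λ { zero → f ; (suc _) → f ⊕ g }
  ; gens       = λ { zero → gs ; (suc _) → g ∷ gs }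
  ; coords     = λ { zero c → 0 ∷ c ; (suc _) (a ∷ c) → suc a ∷ c }
  ; agree      = λ { zero c → zero-coefficient f g (comb gs c) ; (suc _) (a ∷ c) → successor (+ a) f g (comb gs c) }
  ; injective  = λ { {zero} {zero} refl → refl ; {zero} {suc _} {c′ = _ ∷ _} () ; {suc _} {zero} {c = _ ∷ _} ()
                   ; {suc zero} {suc zero} {_ ∷ _} {_ ∷ _} refl → refl }
  ; surjective = λ { (zero ∷ c) → zero , c , refl ; (suc a ∷ c) → suc zero , a ∷ c , refl }
  }
  where
  zero-coefficient : ∀ {d} (f g r : Point d) → f ⊕ r ≡ f ⊕ (0ℤ • g ⊕ r)
  zero-coefficient [] [] [] = refl
  zero-coefficient (x ∷ f) (y ∷ g) (z ∷ r) = cong₂ _∷_ (cong (x +ℤ_) (sym (ℤ.+-identityˡ z))) (zero-coefficient f g r)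
  successor : ∀ a {d} (f g r : Point d) → (f ⊕ g) ⊕ (a • g ⊕ r) ≡ f ⊕ ((1ℤ +ℤ a) • g ⊕ r)
  successor a [] [] [] = refl
  successor a (x ∷ f) (y ∷ g) (z ∷ r) = cong₂ _∷_ (pointwise a x y z) (successor a f g r)
    where
    pointwise : ∀ a x y z → x +ℤ y +ℤ (a *ℤ y +ℤ z) ≡ x +ℤ ((1ℤ +ℤ a) *ℤ y +ℤ z)
    pointwise = solve-∀

-- The cases a ≥ b and a < b for the first two coefficients a and b.
compare-heads : (f g h : Point d) (gs : Vec (Point d) k) → Subdivision f (g ∷ h ∷ gs)
compare-heads {k = k} f g h gs = record
  { Index      = Fin 2
  ; summable   = Fin-summable 2
  ; size       = λ _ → 2 ℕ.+ k
  -- Ties go to the first cell; the offset `h` makes the inequality in the second one strict.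
  ; base       = λ { zero → f ; (suc _) → f ⊕ h }
  ; gens       = λ { zero → g ∷ g ⊕ h ∷ gs ; (suc _) → h ∷ g ⊕ h ∷ gs }
  ; coords     = coords
  ; agree      = λ { zero (a ∷ b ∷ c) → agree₀ (+ a) (+ b) f g h (comb gs c)
                   ; (suc _) (a ∷ b ∷ c) → agree₁ (+ a) (+ b) f g h (comb gs c) }
  ; injective  = injective
  ; surjective = surjective
  }
  where
  coords : Fin 2 → Vec ℕ (2 ℕ.+ k) → Vec ℕ (2 ℕ.+ k)
  coords zero    (a ∷ b ∷ c) = a ℕ.+ b ∷ b ∷ c
  coords (suc _) (a ∷ b ∷ c) = b ∷ suc (a ℕ.+ b) ∷ c
  agree₀ : ∀ a b {d} (f g h r : Point d) → f ⊕ (a • g ⊕ (b • (g ⊕ h) ⊕ r)) ≡ f ⊕ ((a +ℤ b) • g ⊕ (b • h ⊕ r))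
  agree₀ a b [] [] [] [] = refl
  agree₀ a b (x ∷ f) (y ∷ g) (z ∷ h) (w ∷ r) = cong₂ _∷_ (pointwise a b x y z w) (agree₀ a b f g h r)
    where
    pointwise : ∀ a b x y z w → x +ℤ (a *ℤ y +ℤ (b *ℤ (y +ℤ z) +ℤ w)) ≡ x +ℤ ((a +ℤ b) *ℤ y +ℤ (b *ℤ z +ℤ w))
    pointwise = solve-∀
  agree₁ : ∀ a b {d} (f g h r : Point d) →
    (f ⊕ h) ⊕ (a • h ⊕ (b • (g ⊕ h) ⊕ r)) ≡ f ⊕ (b • g ⊕ ((1ℤ +ℤ (a +ℤ b)) • h ⊕ r))
  agree₁ a b [] [] [] [] = refl
  agree₁ a b (x ∷ f) (y ∷ g) (z ∷ h) (w ∷ r) = cong₂ _∷_ (pointwise a b x y z w) (agree₁ a b f g h r)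
    where
    pointwise : ∀ a b x y z w →
      x +ℤ z +ℤ (a *ℤ z +ℤ (b *ℤ (y +ℤ z) +ℤ w)) ≡ x +ℤ (b *ℤ y +ℤ ((1ℤ +ℤ (a +ℤ b)) *ℤ z +ℤ w))
    pointwise = solve-∀
  injective : ∀ {l l′ c c′} → coords l c ≡ coords l′ c′ → (l , c) ≡ (l′ , c′)
  injective {zero} {zero} {a ∷ b ∷ c} {a′ ∷ b′ ∷ c′} eq with Vec.∷-injective eq
  ... | a+b≡ , refl = cong (λ a → zero , a ∷ b ∷ c) (ℕ.+-cancelʳ-≡ b a a′ a+b≡)
  injective {suc zero} {suc zero} {a ∷ b ∷ c} {a′ ∷ b′ ∷ c′} eq with Vec.∷-injective eq
  ... | refl , eq′ with Vec.∷-injective eq′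
  ...   | a+b≡ , refl = cong (λ a → suc zero , a ∷ b ∷ c) (ℕ.+-cancelʳ-≡ b a a′ (ℕ.suc-injective a+b≡))
  injective {zero} {suc zero} {a ∷ b ∷ c} {a′ ∷ b′ ∷ c′} eq with Vec.∷-injective eq
  ... | refl , eq′ = contradiction (proj₁ (Vec.∷-injective eq′)) (ℕ.<⇒≢ (ℕ.s≤s (ℕ.≤-trans (ℕ.m≤n+m b a) (ℕ.m≤n+m _ a′))))
  injective {suc zero} {zero} {a ∷ b ∷ c} {a′ ∷ b′ ∷ c′} eq with Vec.∷-injective eq
  ... | refl , eq′ = contradiction (sym (proj₁ (Vec.∷-injective eq′))) (ℕ.<⇒≢ (ℕ.s≤s (ℕ.≤-trans (ℕ.m≤n+m b′ a′) (ℕ.m≤n+m _ a))))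
  surjective : ∀ c → ∃ λ l → ∃ λ c′ → coords l c′ ≡ c
  surjective (p ∷ q ∷ c) with q ℕ.≤? p
  ... | yes q≤p = zero , p ℕ.∸ q ∷ q ∷ c , cong (_∷ q ∷ c) (ℕ.m∸n+n≡m q≤p)
  ... | no  q≰p = suc zero , q ℕ.∸ suc p ∷ p ∷ c ,
    cong (λ q → p ∷ q ∷ c) (trans (sym (ℕ.+-suc _ p)) (ℕ.m∸n+n≡m (ℕ.≰⇒> q≰p)))

module _ (m : ℕ) {{_ : NonZero m}} where

  remainder-unique : ∀ (r r′ : Fin m) a a′ → toℕ r ℕ.+ a ℕ.* m ≡ toℕ r′ ℕ.+ a′ ℕ.* m → r ≡ r′ × a ≡ a′
  remainder-unique r r′ a a′ eq with Fin.toℕ-injective {i = r} {r′} (begin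
    toℕ r                       ≡⟨ residue r a ⟨
    (toℕ r ℕ.+ a ℕ.* m) % m     ≡⟨ cong (_% m) eq ⟩
    (toℕ r′ ℕ.+ a′ ℕ.* m) % m   ≡⟨ residue r′ a′ ⟩
    toℕ r′                      ∎)
    where
    residue : ∀ (r : Fin m) a → (toℕ r ℕ.+ a ℕ.* m) % m ≡ toℕ r
    residue r a = trans ([m+kn]%n≡m%n (toℕ r) a m) (m<n⇒m%n≡m (Fin.toℕ<n r))
  ... | refl = refl , ℕ.*-cancelʳ-≡ a a′ m (ℕ.+-cancelˡ-≡ (toℕ r) _ _ eq)

  -- Trades `g` for its multiple m g, so that slopes of opposite sign can later be scaled until they
  -- cancel.
  split-by-residue : (f g : Point d) (gs : Vec (Point d) k) → Subdivision f (g ∷ gs)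
  split-by-residue f g gs = record
    { summable   = Fin-summable m
    ; size       = λ _ → _
    ; base       = λ r → f ⊕ (+ toℕ r) • g
    ; gens       = λ _ → (+ m) • g ∷ gs
    ; coords     = λ { r (a ∷ c) → toℕ r ℕ.+ a ℕ.* m ∷ c }
    ; agree      = λ { r (a ∷ c) → trans (agree (+ toℕ r) (+ a) (+ m) f g (comb gs c))
        (cong (λ n → f ⊕ ((+ toℕ r +ℤ n) • g ⊕ comb gs c)) (sym (ℤ.pos-* a m))) }
    ; injective  = λ { {r} {r′} {a ∷ c} {a′ ∷ c′} eq → injective r r′ a a′ c c′ (Vec.∷-injective eq) }
    ; surjective = λ { (n ∷ c) → let result q r n≡ = n divMod m in r , q ∷ c , cong (_∷ c) (sym n≡) }
    }
    where
    agree : ∀ r a m {d} (f g s : Point d) → (f ⊕ r • g) ⊕ (a • m • g ⊕ s) ≡ f ⊕ ((r +ℤ a *ℤ m) • g ⊕ s)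
    agree r a m [] [] [] = refl
    agree r a m (x ∷ f) (y ∷ g) (z ∷ s) = cong₂ _∷_ (pointwise r a m x y z) (agree r a m f g s)
      where
      pointwise : ∀ r a m x y z → x +ℤ r *ℤ y +ℤ (a *ℤ (m *ℤ y) +ℤ z) ≡ x +ℤ ((r +ℤ a *ℤ m) *ℤ y +ℤ z)
      pointwise = solve-∀
    injective : ∀ r r′ a a′ (c c′ : Vec ℕ k) → (toℕ r ℕ.+ a ℕ.* m ≡ toℕ r′ ℕ.+ a′ ℕ.* m) × c ≡ c′ →
      (r , a ∷ c) ≡ (r′ , a′ ∷ c′)
    injective r r′ a a′ c c′ (eq , refl) with remainder-unique r r′ a a′ eq
    ... | refl , refl = refl

-- Eliminating the sign conditions one form at a time

nonneg-+ : ∀ y z → nonneg y ≡ true → nonneg z ≡ true → nonneg (y +ℤ z) ≡ true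
nonneg-+ (+ _) (+ _) _ _ = refl

nonneg-* : ∀ n z → nonneg z ≡ true → nonneg (+ n *ℤ z) ≡ true
nonneg-* n (+ m) _ rewrite sym (ℤ.pos-* n m) = refl

slope-𝟎 : (ℓ : Form d) → slope ℓ 𝟎 ≡ 0ℤ
slope-𝟎 ℓ = trans (cong (slope ℓ) (sym (•-zeroˡ 𝟎))) (slope-• ℓ 0ℤ 𝟎)

slope-comb-nonneg : (ℓ : Form d) {gs : Vec (Point d) k} → AllV (λ g → nonneg (slope ℓ g) ≡ true) gs →
  ∀ c → nonneg (slope ℓ (comb gs c)) ≡ true
slope-comb-nonneg ℓ [] [] = cong nonneg (slope-𝟎 ℓ)
slope-comb-nonneg ℓ {g ∷ gs} (p ∷ ps) (a ∷ c) = trans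
  (cong nonneg (trans (slope-⊕ ℓ _ _) (cong (_+ℤ slope ℓ (comb gs c)) (slope-• ℓ (+ a) g))))
  (nonneg-+ _ _ (nonneg-* a _ p) (slope-comb-nonneg ℓ ps c))

slope-comb-zero : (ℓ : Form d) {gs : Vec (Point d) k} → AllV (λ g → slope ℓ g ≡ 0ℤ) gs → ∀ c → slope ℓ (comb gs c) ≡ 0ℤ
slope-comb-zero ℓ [] [] = slope-𝟎 ℓ
slope-comb-zero ℓ {g ∷ gs} (p ∷ ps) (a ∷ c) = begin
  slope ℓ ((+ a) • g ⊕ comb gs c)             ≡⟨ slope-⊕ ℓ _ _ ⟩
  slope ℓ ((+ a) • g) +ℤ slope ℓ (comb gs c)  ≡⟨ cong₂ _+ℤ_ (slope-• ℓ (+ a) g) (slope-comb-zero ℓ ps c) ⟩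
  + a *ℤ slope ℓ g +ℤ 0ℤ                      ≡⟨ cong (λ z → + a *ℤ z +ℤ 0ℤ) p ⟩
  + a *ℤ 0ℤ +ℤ 0ℤ                             ≡⟨ cong (_+ℤ 0ℤ) (ℤ.*-zeroʳ (+ a)) ⟩
  0ℤ                                          ∎

removeAt⁺ : {A : Set} {P : A → Set} {xs : Vec A (suc k)} → AllV P xs → ∀ i → AllV P (removeAt xs i)
removeAt⁺ (p ∷ ps) zero = ps
removeAt⁺ (p ∷ ps@(_ ∷ _)) (suc i) = p ∷ removeAt⁺ ps i

module _ {d} {W : Subset d} {ℓs : List (Form d)} (stratify : ∀ {k} f (gs : Vec (Point d) k) → Stratifies W ℓs f gs) where

  constant-sign : (ℓ : Form d) (f : Point d) (gs : Vec (Point d) k) (b : Bool) →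
    (∀ c → nonneg (at ℓ (param f gs c)) ≡ b) → Stratifies W (ℓ ∷ ℓs) f gs
  constant-sign ℓ f gs b sign tame = stratify f gs record
    { free       = free
    ; determined = λ c c′ same → determined c c′ (trans (sign c) (sym (sign c′)) ∷ same)
    } where open Tame tame

  -- Splitting off a generator of positive slope either removes it or raises the value at the base point,
  -- which is at least -n.
  nonneg-slopes : ∀ {k} (n : ℕ) (ℓ : Form d) (f : Point d) (gs : Vec (Point d) k) →
    AllV (λ g → nonneg (slope ℓ g) ≡ true) gs → nonneg (at ℓ f +ℤ + n) ≡ true → Stratifies W (ℓ ∷ ℓs) f gs
  nonneg-slopes zero ℓ f gs ≥0 f≥0 = constant-sign ℓ f gs true λ c → trans (cong nonneg (at-⊕ ℓ f _))
    (nonneg-+ _ _ (trans (cong nonneg (sym (ℤ.+-identityʳ (at ℓ f)))) f≥0) (slope-comb-nonneg ℓ ≥0 c))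
  nonneg-slopes {zero} (suc n) ℓ f [] _ _ = constant-sign ℓ f [] _ λ { [] → cong (nonneg ∘ at ℓ) (⊕-identityʳ f) }
  nonneg-slopes {suc k} (suc n) ℓ f gs ≥0 f+n≥0 with Fin.any? (λ i → ¬? (slope ℓ (lookup gs i) ℤ.≟ 0ℤ))
  ... | no  all-zero = constant-sign ℓ f gs (nonneg (at ℓ f)) λ c → cong nonneg (trans (at-⊕ ℓ f _)
    (trans (cong (at ℓ f +ℤ_) (slope-comb-zero ℓ (AllV.lookup⁻ {xs = gs} is-zero) c)) (ℤ.+-identityʳ _)))
    where
    is-zero : ∀ i → slope ℓ (lookup gs i) ≡ 0ℤ
    is-zero i with slope ℓ (lookup gs i) ℤ.≟ 0ℤ
    ... | yes s≡0 = s≡0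
    ... | no  s≢0 = contradiction (i , s≢0) all-zero
  ... | yes (i , s≢0) = subdivide (bring-to-front f gs i) λ _ → subdivide (split-off-zero f g (removeAt gs i)) λ
    -- Here k drops and n stays; in the other cell n drops and k stays, because the slope of g is at
    -- least 1 and raises the value at the base.
    { zero    → nonneg-slopes {k} (suc n) ℓ f (removeAt gs i) (removeAt⁺ ≥0 i) f+n≥0
    ; (suc _) → nonneg-slopes {suc k} n ℓ (f ⊕ g) (g ∷ removeAt gs i) (AllV.lookup⁺ ≥0 i ∷ removeAt⁺ ≥0 i)
        (trans (cong (λ z → nonneg (z +ℤ + n)) (at-⊕ ℓ f g)) (step (at ℓ f) (slope ℓ g) (AllV.lookup⁺ ≥0 i) s≢0 f+n≥0)) }
    where
    g : Point d
    g = lookup gs i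
    regroup : ∀ a s n → a +ℤ (1ℤ +ℤ s) +ℤ n ≡ a +ℤ (1ℤ +ℤ n) +ℤ s
    regroup = solve-∀
    step : ∀ a s → nonneg s ≡ true → s ≢ 0ℤ → nonneg (a +ℤ + suc n) ≡ true → nonneg (a +ℤ s +ℤ + n) ≡ true
    step a (+ zero) _ s≢0 _ = contradiction refl s≢0
    step a +[1+ s ] _ _ a+n≥0 = trans (cong nonneg (regroup a (+ s) (+ n))) (nonneg-+ (a +ℤ + suc n) (+ s) a+n≥0 refl)

  from-nonneg-slopes : (ℓ : Form d) (f : Point d) (gs : Vec (Point d) k) →
    AllV (λ g → nonneg (slope ℓ g) ≡ true) gs → Stratifies W (ℓ ∷ ℓs) f gs
  from-nonneg-slopes ℓ f gs ≥0 = nonneg-slopes ∣ at ℓ f ∣ ℓ f gs ≥0 (z+∣z∣ (at ℓ f))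
    where
    z+∣z∣ : ∀ z → nonneg (z +ℤ + ∣ z ∣) ≡ true
    z+∣z∣ (+ n)    = refl
    z+∣z∣ -[1+ n ] = cong nonneg (ℤ.+-inverseˡ (+ suc n))

  -- ℓ < 0 if and only if -1 - ℓ ≥ 0.
  from-nonpos-slopes : (ℓ : Form d) (f : Point d) (gs : Vec (Point d) k) →
    AllV (λ g → nonneg (- slope ℓ g) ≡ true) gs → Stratifies W (ℓ ∷ ℓs) f gs
  from-nonpos-slopes ℓ f gs ≤0 tame = from-nonneg-slopes opposite f gs
    (AllV.map (λ {g} p → trans (cong nonneg (opposite-slope (slope ℓ g))) p) ≤0) record
    { free       = free
    ; determined = λ { c c′ (e ∷ same) → determined c c′ (Bool.not-injective
        (trans (sym (flip _)) (trans e (flip _))) ∷ same) }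
    }
    where
    open Tame tame
    opposite : Form d
    opposite = linear -1ℤ ℓ 1ℤ (constant -1ℤ)
    opposite-slope : ∀ s → -1ℤ *ℤ s +ℤ 1ℤ *ℤ 0ℤ ≡ - s
    opposite-slope = solve-∀
    flip : ∀ z → nonneg (-1ℤ *ℤ z +ℤ 1ℤ *ℤ -1ℤ) ≡ not (nonneg z)
    flip z rewrite ℤ.-1*i≡-i z with z
    ... | + zero   = refl
    ... | +[1+ n ] = refl
    ... | -[1+ n ] = refl

  weight : ℤ → ℕ
  weight (+ zero) = 0
  weight _        = 1

  weight≤1 : ∀ z → weight z ℕ.≤ 1
  weight≤1 (+ zero) = ℕ.z≤n
  weight≤1 +[1+ _ ] = ℕ.≤-refl
  weight≤1 -[1+ _ ] = ℕ.≤-refl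

  module _ (ℓ : Form d) where

    -- The termination measure: two generators of nonzero slope are exchanged for one of them and a
    -- sum of slope 0.
    support : Vec (Point d) k → ℕ
    support []       = 0
    support (g ∷ gs) = weight (slope ℓ g) ℕ.+ support gs

    support-front : (gs : Vec (Point d) (suc k)) (i : Fin (suc k)) → support (lookup gs i ∷ removeAt gs i) ≡ support gs
    support-front (g ∷ gs) zero = refl
    support-front (g ∷ gs@(_ ∷ _)) (suc i) = begin
      p ℕ.+ (q ℕ.+ r)   ≡⟨ ℕ.+-assoc p q r ⟨
      p ℕ.+ q ℕ.+ r     ≡⟨ cong (ℕ._+ r) (ℕ.+-comm p q) ⟩
      q ℕ.+ p ℕ.+ r     ≡⟨ ℕ.+-assoc q p r ⟩
      q ℕ.+ (p ℕ.+ r)   ≡⟨ cong (q ℕ.+_) (support-front gs i) ⟩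
      q ℕ.+ support gs  ∎
      where
      p q r : ℕ
      p = weight (slope ℓ (lookup gs i))
      q = weight (slope ℓ g)
      r = support (removeAt gs i)

    -- After residue splitting, generators of opposite slopes have slopes s and -s, so their sum has slope 0.
    bounded-support : ∀ (n : ℕ) {k} f (gs : Vec (Point d) k) → support gs ℕ.≤ n → Stratifies W (ℓ ∷ ℓs) f gs
    positive-head : ∀ (n : ℕ) {k} f g (gs : Vec (Point d) k) →
      nonneg (- slope ℓ g) ≡ false → support (g ∷ gs) ℕ.≤ n → Stratifies W (ℓ ∷ ℓs) f (g ∷ gs)
    opposite-heads : ∀ (n : ℕ) {k} f h g (gs : Vec (Point d) k) p q →
      slope ℓ h ≡ -[1+ p ] → slope ℓ g ≡ +[1+ q ] → support (h ∷ g ∷ gs) ℕ.≤ n → Stratifies W (ℓ ∷ ℓs) f (h ∷ g ∷ gs)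

    bounded-support n {zero} f [] _ = from-nonneg-slopes ℓ f [] []
    -- For a slope s, `nonneg (- s) ≡ false` expresses s > 0, and `nonneg s ≡ false` expresses s <
    -- 0.
    bounded-support n {suc k} f gs s≤n with Fin.any? (λ i → nonneg (- slope ℓ (lookup gs i)) Bool.≟ false)
    ... | yes (i , pos) = subdivide (bring-to-front f gs i) λ _ →
      positive-head n f (lookup gs i) (removeAt gs i) pos (subst (ℕ._≤ n) (sym (support-front gs i)) s≤n)
    ... | no none = from-nonpos-slopes ℓ f gs (AllV.lookup⁻ λ i → Bool.¬-not λ eq → none (i , eq))

    positive-head n f g gs pos s≤n with Fin.any? (λ i → nonneg (slope ℓ (lookup gs i)) Bool.≟ false)
    ... | no none = from-nonneg-slopes ℓ f (g ∷ gs) (positive (slope ℓ g) pos ∷ AllV.lookup⁻ λ i → Bool.¬-not λ eq → none (i , eq))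
      where
      positive : ∀ z → nonneg (- z) ≡ false → nonneg z ≡ true
      positive (+ n) _ = refl
    positive-head n f g gs@(_ ∷ _) pos s≤n | yes (j , neg) with slope ℓ g in g≡ | slope ℓ (lookup gs j) in h≡
    ... | +[1+ q ] | -[1+ p ] = subdivide (bring-to-front f (g ∷ gs) (suc j)) λ _ →
      opposite-heads n f (lookup gs j) g (removeAt gs j) p q h≡ g≡
        (subst (ℕ._≤ n) (sym (trans (support-front (g ∷ gs) (suc j)) (cong (λ s → weight s ℕ.+ support gs) g≡))) s≤n)

    opposite-heads zero f h g gs p q h≡ g≡ s≤n = contradiction s≤n λ s≤0 → ℕ.n≮0
      (subst (ℕ._≤ 0) (cong₂ (λ s t → weight s ℕ.+ (weight t ℕ.+ support gs)) h≡ g≡) s≤0)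
    opposite-heads (suc n) f h g gs p q h≡ g≡ s≤n =
      -- The slopes of h and g are -(p+1) and q+1, so (q+1) h and (p+1) g have opposite slopes.
      subdivide (split-by-residue (suc q) f h (g ∷ gs)) λ r →
      subdivide (bring-to-front (f ⊕ (+ toℕ r) • h) ((+ suc q) • h ∷ g ∷ gs) (suc zero)) λ _ →
      subdivide (split-by-residue (suc p) (f ⊕ (+ toℕ r) • h) g ((+ suc q) • h ∷ gs)) λ s →
      -- Both cells keep one scaled generator beside the sum, so the support is now at most n.
      subdivide (compare-heads ((f ⊕ (+ toℕ r) • h) ⊕ (+ toℕ s) • g) ((+ suc p) • g) ((+ suc q) • h) gs) λ
      { zero    → bounded-support n _ _ (smaller ((+ suc p) • g))
      ; (suc _) → bounded-support n _ _ (smaller ((+ suc q) • h)) }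
      where
      cancels : slope ℓ ((+ suc p) • g ⊕ (+ suc q) • h) ≡ 0ℤ
      cancels = begin
        slope ℓ ((+ suc p) • g ⊕ (+ suc q) • h)            ≡⟨ slope-⊕ ℓ _ _ ⟩
        slope ℓ ((+ suc p) • g) +ℤ slope ℓ ((+ suc q) • h) ≡⟨ cong₂ _+ℤ_ (slope-• ℓ (+ suc p) g) (slope-• ℓ (+ suc q) h) ⟩
        + suc p *ℤ slope ℓ g +ℤ + suc q *ℤ slope ℓ h       ≡⟨ cong₂ (λ s t → + suc p *ℤ s +ℤ + suc q *ℤ t) g≡ h≡ ⟩
        + suc p *ℤ + suc q +ℤ + suc q *ℤ (- + suc p)       ≡⟨ opposite (+ suc p) (+ suc q) ⟩
        0ℤ                                                 ∎
        where
        opposite : ∀ a b → a *ℤ b +ℤ b *ℤ (- a) ≡ 0ℤ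
        opposite = solve-∀
      support≤ : suc (support gs) ℕ.≤ n
      support≤ = ℕ.≤-pred (subst (ℕ._≤ suc n) (cong₂ (λ s t → weight s ℕ.+ (weight t ℕ.+ support gs)) h≡ g≡) s≤n)
      smaller : ∀ e → support (e ∷ (+ suc p) • g ⊕ (+ suc q) • h ∷ gs) ℕ.≤ n
      smaller e = ℕ.≤-trans (ℕ.+-mono-≤ (weight≤1 (slope ℓ e)) (ℕ.≤-reflexive (cong (λ s → weight s ℕ.+ support gs) cancels))) support≤

tame-stratification : {W : Subset d} → (∀ x → Dec (W x)) → ∀ ℓs {k} f (gs : Vec (Point d) k) → Stratifies W ℓs f gs
-- With no forms left, `determined` makes W constant on the cell, and testing the base point
-- decides.
tame-stratification {W = W} dec [] {k} f gs tame with dec (param f gs (Vec.replicate k 0))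
... | yes w = AffineStratification-≐
  (λ { x x∈ → let c , x≡ = Translate⇒Cell f gs x x∈ in
       subst W (sym x≡) (Tame.determined tame (Vec.replicate k 0) c [] w) , c , x≡ })
  (λ x → Cell⇒Translate f gs x ∘ proj₂)
  (piece-stratification (piece (f ∷ []) (toList gs)))
... | no ¬w = ∅-stratification λ { x (w , c , refl) → ¬w (Tame.determined tame c (Vec.replicate k 0) [] w) }
tame-stratification dec (ℓ ∷ ℓs) f gs =
  bounded-support (tame-stratification dec ℓs) ℓ _ f gs ℕ.≤-refl

-- Partition of ℤ^d into boxes

•-zeroʳ : ∀ z → z • 𝟎 {d} ≡ 𝟎
•-zeroʳ {zero} z = refl
•-zeroʳ {suc d} z = cong₂ _∷_ (ℤ.*-zeroʳ z) (•-zeroʳ z)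

comb-0∷ : (gs : Vec (Point d) k) (c : Vec ℕ k) → comb (Vec.map (0ℤ ∷_) gs) c ≡ 0ℤ ∷ comb gs c
comb-0∷ []       []      = refl
comb-0∷ (g ∷ gs) (a ∷ c) = trans (cong ((+ a) • (0ℤ ∷ g) ⊕_) (comb-0∷ gs c))
  (cong (_∷ (+ a) • g ⊕ comb gs c) (trans (ℤ.+-identityʳ _) (ℤ.*-zeroʳ (+ a))))

module _ (m : ℕ) {{_ : NonZero m}} where

  -- ℤ is the disjoint union of the rays r, r + m, r + 2m, … and -1 - r, -1 - r - m, … over the residues r.
  Ray : Set
  Ray = Fin m ⊎ Fin m

  start direction : Ray → ℤ
  start     (inj₁ r) = + toℕ r
  start     (inj₂ r) = -[1+ toℕ r ]
  direction (inj₁ _) = + m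
  direction (inj₂ _) = - + m

  -- Follows the two constructors of ℤ, so that bijectivity reduces to division with remainder in ℕ.
  -- Starting at -1 - r keeps zero out of the negative rays.
  point : Ray → ℕ → ℤ
  point (inj₁ r) a = + (toℕ r ℕ.+ a ℕ.* m)
  point (inj₂ r) a = -[1+ toℕ r ℕ.+ a ℕ.* m ]

  point≡ : ∀ l a → point l a ≡ start l +ℤ + a *ℤ direction l
  point≡ (inj₁ r) a = cong (+ toℕ r +ℤ_) (ℤ.pos-* a m)
  point≡ (inj₂ r) a = trans (negate (+ toℕ r) (+ (a ℕ.* m))) (trans
    (cong (λ n → - (1ℤ +ℤ + toℕ r) +ℤ - n) (ℤ.pos-* a m))
    (cong (-[1+ toℕ r ] +ℤ_) (ℤ.neg-distribʳ-* (+ a) (+ m))))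
    where
    negate : ∀ r n → - (1ℤ +ℤ (r +ℤ n)) ≡ - (1ℤ +ℤ r) +ℤ - n
    negate = solve-∀

  point-injective : ∀ l l′ a a′ → point l a ≡ point l′ a′ → l ≡ l′ × a ≡ a′
  point-injective (inj₁ r) (inj₁ r′) a a′ eq with remainder-unique m r r′ a a′ (ℤ.+-injective eq)
  ... | refl , refl = refl , refl
  point-injective (inj₂ r) (inj₂ r′) a a′ eq with remainder-unique m r r′ a a′ (ℤ.-[1+-injective eq)
  ... | refl , refl = refl , refl

  point-surjective : ∀ z → ∃ λ l → ∃ λ a → point l a ≡ z
  point-surjective (+ n) = let result q r n≡ = n divMod m in inj₁ r , q , cong +_ (sym n≡)
  point-surjective -[1+ n ] = let result q r n≡ = n divMod m in inj₂ r , q , cong -[1+_] (sym n≡)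

  corner : Vec Ray d → Point d
  corner = Vec.map start

  axes : Vec Ray d → Vec (Point d) d
  axes []      = []
  axes (l ∷ σ) = (direction l ∷ 𝟎) ∷ Vec.map (0ℤ ∷_) (axes σ)

  param-box : (σ : Vec Ray d) (c : Vec ℕ d) → param (corner σ) (axes σ) c ≡ zipWith point σ c
  param-box []      []      = refl
  param-box (l ∷ σ) (a ∷ c) = begin
    (start l ∷ corner σ) ⊕ ((+ a) • (direction l ∷ 𝟎) ⊕ comb (Vec.map (0ℤ ∷_) (axes σ)) c)
      ≡⟨ cong (λ v → (start l ∷ corner σ) ⊕ ((+ a) • (direction l ∷ 𝟎) ⊕ v)) (comb-0∷ (axes σ) c) ⟩
    (start l +ℤ (+ a *ℤ direction l +ℤ 0ℤ)) ∷ (corner σ ⊕ ((+ a) • 𝟎 ⊕ comb (axes σ) c))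
      ≡⟨ cong₂ _∷_ (trans (cong (start l +ℤ_) (ℤ.+-identityʳ _)) (sym (point≡ l a)))
           (trans (cong (corner σ ⊕_) (trans (cong (_⊕ comb (axes σ) c) (•-zeroʳ (+ a))) (trans (⊕-comm _ _) (⊕-identityʳ _)))) (param-box σ c)) ⟩
    point l a ∷ zipWith point σ c ∎

  box-injective : (σ σ′ : Vec Ray d) (c c′ : Vec ℕ d) → zipWith point σ c ≡ zipWith point σ′ c′ → σ ≡ σ′ × c ≡ c′
  box-injective []      []        []      []        _  = refl , refl
  box-injective (l ∷ σ) (l′ ∷ σ′) (a ∷ c) (a′ ∷ c′) eq with Vec.∷-injective eq
  ... | eq₁ , eq₂ with point-injective l l′ a a′ eq₁ | box-injective σ σ′ c c′ eq₂
  ...   | refl , refl | refl , refl = refl , refl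

  box-surjective : (x : Point d) → ∃ λ σ → ∃ λ c → zipWith point σ c ≡ x
  box-surjective []      = [] , [] , refl
  box-surjective (z ∷ x) = let l , a , eq₁ = point-surjective z ; σ , c , eq₂ = box-surjective x in
    l ∷ σ , a ∷ c , cong₂ _∷_ eq₁ eq₂

  -- All directions are m or -m, so coordinates vary by multiples of m within a box. This discharges
  -- the congruence when passing to `Tame`.
  box-congruent : (σ : Vec Ray d) (c c′ : Vec ℕ d) → Congruent m (zipWith point σ c) (zipWith point σ c′)
  box-congruent []      []      []        = [] , refl
  box-congruent (l ∷ σ) (a ∷ c) (a′ ∷ c′) =
    let t , eq₁ = on-ray l ; v , eq₂ = box-congruent σ c c′ in t ∷ v , cong₂ _∷_ eq₁ eq₂
    where
    difference : ∀ s a a′ m → s +ℤ a′ *ℤ m ≡ s +ℤ a *ℤ m +ℤ m *ℤ (a′ +ℤ - a)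
    difference = solve-∀
    difference⁻ : ∀ s a a′ m → s +ℤ a′ *ℤ (- m) ≡ s +ℤ a *ℤ (- m) +ℤ m *ℤ (a +ℤ - a′)
    difference⁻ = solve-∀
    on-ray : ∀ l → ∃ λ t → point l a′ ≡ point l a +ℤ + m *ℤ t
    on-ray l@(inj₁ r) = + a′ +ℤ - + a , trans (point≡ l a′) (trans (difference (start l) (+ a) (+ a′) (+ m))
      (cong (_+ℤ + m *ℤ (+ a′ +ℤ - + a)) (sym (point≡ l a))))
    on-ray l@(inj₂ r) = + a +ℤ - + a′ , trans (point≡ l a′) (trans (difference⁻ (start l) (+ a) (+ a′) (+ m))
      (cong (_+ℤ + m *ℤ (+ a +ℤ - + a′)) (sym (point≡ l a))))

-- Presburger sets are affinely stratified

presburger⇒stratified : {W : Subset d} → Presburger W → AffineStratification W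
presburger⇒stratified {d} {W} P = AffineStratification-≐
  (λ { x (σ , w , _) → w })
  (λ x w → let σ , c , eq = box-surjective modulus x in σ , w , c , trans (sym eq) (sym (param-box modulus σ c)))
  (Summable.⋃-stratification (Vec-summable (⊎-summable (Fin-summable modulus) (Fin-summable modulus)) d)
    (λ σ x → W x × Cell (corner modulus σ) (axes modulus σ) x)
    (λ { {σ} {σ′} (_ , c , eq) (_ , c′ , eq′) → proj₁ (same-box σ σ′ c c′ (trans (sym eq) eq′)) })
    (λ σ → tame-stratification dec forms (corner modulus σ) (axes modulus σ) record
      { free       = λ {c} {c′} eq → proj₂ (same-box σ σ c c′ eq)
      ; determined = λ c c′ same → determined same
          (subst₂ (Congruent modulus) (sym (param-box modulus σ c)) (sym (param-box modulus σ c′)) (box-congruent modulus σ c c′))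
      }))
  where
  open Presburger P
  same-box : (σ σ′ : Vec (Ray modulus) d) (c c′ : Vec ℕ d) →
    param (corner modulus σ) (axes modulus σ) c ≡ param (corner modulus σ′) (axes modulus σ′) c′ → σ ≡ σ′ × c ≡ c′
  same-box σ σ′ c c′ eq = box-injective modulus σ σ′ c c′
    (trans (sym (param-box modulus σ c)) (trans eq (param-box modulus σ′ c′)))

theorem4p2 : (d : ℕ) (A B : Subset d) → B ⊆ A →
    AffineStratification A → AffineStratification B →
    AffineStratification (A ∖ B)
theorem4p2 d A B _ SA SB =
  presburger⇒stratified (∖-presburger (stratified⇒presburger SA) (stratified⇒presburger SB))
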